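{- Let $\alpha,\beta$ be partitions with $|\alpha|=|\beta|$. Suppose that there does not exist a partition $\mu$ such that $\alpha=\mu_{(1)}$ and $\beta=(\mu')_{(1)}$. Then there exists a sign-reversing involution on $X_{\alpha,\beta,1}$, i.e. a map $\varphi\colon X_{\alpha,\beta,1}\to X_{\alpha,\beta,1}$ with $\varphi\circ\varphi=\mathrm{id}$ and $\operatorname{sgn}(\varphi(\chi))=-\operatorname{sgn}(\chi)$ for all $\chi\in X_{\alpha,\beta,1}$.
   Context: Partitions are identified with their Young diagrams (English notation; box $(i,j)$ is in row $i$, column $j$). $\mu'$ is the conjugate (transpose) of $\mu$, $\ell(\mu)$ its number of nonzero rows, $|\mu|$ its size, and $\emptyset$ the empty partition. The rank $r(\mu)$ is the greatest integer $k\ge 0$ with $\mu_k\ge k$ (side length of the Durfee square; $r(\emptyset)=0$). The $k$-stabilization $\mu_{(k)}$ is the partition obtained from $\mu$ by adding $k$ rows of length $r(\mu)$ (inserted so that the rows remain weakly decreasing). For partitions $\nu\subseteq\alpha$, a tableau of skew shape $\alpha/\nu$ is a filling of the boxes of $\alpha$ not in $\nu$ with positive integers; it is semistandard if rows weakly increase left to right and columns strictly increase top to bottom. Its content is $(c_1,c_2,\dots)$ with $c_i$ the number of labels equal to $i$. Its reverse reading word is obtained by reading the rows right to left, from top to bottom. A word is lattice if for every $i\ge1$ each initial segment contains at least as many $i$'s as $(i+1)$'s. A Littlewood--Richardson tableau is a semistandard tableau whose reverse reading word is lattice. $\mathrm{LR}(\alpha/\nu,\lambda)$ denotes the set of Littlewood--Richardson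 tableaux of shape $\alpha/\nu$ and content $\lambda$ (empty if $\nu\not\subseteq\alpha$). For partitions $\alpha,\beta$ with $|\alpha|=|\beta|$ and $k\ge0$, define $$X_{\alpha,\beta}(\lambda,\nu)=\mathrm{LR}(\alpha/\nu,\lambda)\times\mathrm{LR}(\beta/\nu',\lambda),\qquad X_{\alpha,\beta,k}=\bigsqcup_{\lambda,\nu:\ \ell(\lambda)\le k}X_{\alpha,\beta}(\lambda,\nu),$$ where $\lambda,\nu$ range over partitions. The sign of $\chi\in X_{\alpha,\beta}(\lambda,\nu)$ is $\operatorname{sgn}(\chi)=(-1)^{|\nu|}$. -}

module Defs where

open import Data.Integer.Base using (ℤ; -1ℤ) renaming (_^_ to _^ℤ_)
open import Data.List.Base
  using (List; []; _∷_; _++_; map; length; filter; concat; reverse; take;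
         replicate; upTo; applyUpTo)
open import Data.List.Extrema.Nat using (max)
open import Data.List.Properties using (filter-some)
open import Data.List.Relation.Binary.Permutation.Propositional using (↭-sym)
open import Data.List.Relation.Binary.Permutation.Propositional.Properties
  using (All-resp-↭)
open import Data.List.Relation.Binary.Sublist.Heterogeneous.Properties
  using (length-mono-≤; ⊆-filter-Sublist)
open import Data.List.Relation.Binary.Sublist.Propositional using (⊆-refl)
open import Data.List.Relation.Unary.All using (All)
import Data.List.Relation.Unary.All.Properties as All
open import Data.List.Relation.Unary.Any using (here)
open import Data.List.Relation.Unary.Linked using (Linked)
import Data.List.Relation.Unary.Linked.Properties as Linked
open import Data.Nat.Base using (ℕ; zero; suc; _∸_; _≤_; _<_; _≥_)
open import Data.Nat.Properties
  using (_≟_; _<?_; ≤-decTotalOrder; <⇒≤)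
open import Data.Nat.ListAction using (sum)
open import Data.Product using (_×_)
open import Relation.Binary.PropositionalEquality using (_≡_; refl)
open import Relation.Binary.Properties.DecTotalOrder ≤-decTotalOrder
  using (≥-decTotalOrder)
open import Data.List.Sort.InsertionSort ≥-decTotalOrder using (insertionSort)
open import Data.List.Sort.Base using (module SortingAlgorithm)
open SortingAlgorithm insertionSort using (sort; sort-↭; sort-↗)

-- All row, column and list positions are counted from 0: the box (i , j) of
-- the literature is (i ∸ 1 , j ∸ 1) here.  Labels themselves start at 1.

nth : {A : Set} → A → List A → ℕ → A
nth d []       _       = d
nth d (x ∷ xs) zero    = x
nth d (x ∷ xs) (suc i) = nth d xs i

-- A partition is the list of its nonzero rows.  The proof fields are
-- irrelevant, so _≡_ on partitions is equality of the lists of rows.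

record Partition : Set where
  constructor mkPartition
  field
    rows        : List ℕ
    .decreasing : Linked _≥_ rows
    .positive   : All (0 <_) rows

open Partition public

row : Partition → ℕ → ℕ
row μ i = nth 0 (rows μ) i

ℓ : Partition → ℕ
ℓ μ = length (rows μ)

∣_∣ : Partition → ℕ
∣ μ ∣ = sum (rows μ)

_⊆_ : Partition → Partition → Set
ν ⊆ α = ∀ i → row ν i ≤ row α i

columnLength : List ℕ → ℕ → ℕ
columnLength rs j = length (filter (j <?_) rs)

columnLength-antitone : ∀ rs j → columnLength rs j ≥ columnLength rs (suc j)
columnLength-antitone rs j = length-mono-≤
  (⊆-filter-Sublist (suc j <?_) (j <?_) (λ { refl → <⇒≤ }) (⊆-refl {x = rs}))

columnLength-positive : ∀ rs {j} → j < nth 0 rs 0 → 0 < columnLength rs j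
columnLength-positive (r ∷ rs) {j} j<r = filter-some (j <?_) (here j<r)

_′ : Partition → Partition
μ ′ = mkPartition
  (applyUpTo (columnLength (rows μ)) (row μ 0))
  (Linked.applyUpTo⁺₂ _ (row μ 0) (columnLength-antitone (rows μ)))
  (All.applyUpTo⁺₁ _ (row μ 0) (columnLength-positive (rows μ)))

-- The greatest k ≥ 1 whose k-th row, at position k ∸ 1, has length at least k;
-- 0 if there is none.  Such a k is at most ℓ μ, as the rows beyond are empty.

rank : Partition → ℕ
rank μ = max 0 (map suc (filter (λ i → i <? row μ i) (upTo (ℓ μ))))

fromRows : List ℕ → Partition
fromRows rs = mkPartition
  (sort positiveRows)
  (sort-↗ positiveRows)
  (All-resp-↭ (↭-sym (sort-↭ positiveRows)) (All.all-filter (0 <?_) rs))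
  where positiveRows = filter (0 <?_) rs

-- For μ = ∅ the added rows have length 0, and fromRows discards them.

stabilization : Partition → ℕ → Partition
stabilization μ k = fromRows (replicate k (rank μ) ++ rows μ)

record Box (α ν : Partition) (i j : ℕ) : Set where
  field
    outside-ν : row ν i ≤ j
    inside-α  : j < row α i

count : ℕ → List ℕ → ℕ
count c w = length (filter (_≟ c) w)

Lattice : List ℕ → Set
Lattice w = ∀ i → 1 ≤ i → ∀ n → count (suc i) (take n w) ≤ count i (take n w)

-- A filling of α/ν is the list, over the rows i of α, of the labels of row i of
-- α/ν from left to right; the first of these labels is in column row ν i.

Filling : Set
Filling = List (List ℕ)

label : Partition → Filling → ℕ → ℕ → ℕ
label ν T i j = nth 0 (nth [] T i) (j ∸ row ν i)

reverseReadingWord : Filling → List ℕ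
reverseReadingWord T = concat (map reverse T)

record IsLR (α ν lam : Partition) (T : Filling) : Set where
  field
    contained      : ν ⊆ α
    shape          : map length T ≡ applyUpTo (λ i → row α i ∸ row ν i) (ℓ α)
    positiveLabels : ∀ i j → Box α ν i j → 1 ≤ label ν T i j
    rowsWeak       : ∀ i j j₁ → j < j₁ → Box α ν i j → Box α ν i j₁ →
                     label ν T i j ≤ label ν T i j₁
    columnsStrict  : ∀ i i₁ j → i < i₁ → Box α ν i j → Box α ν i₁ j →
                     label ν T i j < label ν T i₁ j
    content        : ∀ i → count (suc i) (concat T) ≡ row lam i
    lattice        : Lattice (reverseReadingWord T)

-- As for partitions, _≡_ on LR α ν lam is equality of fillings.

record LR (α ν lam : Partition) : Set where
  constructor mkLR
  field
    filling : Filling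
    .isLR   : IsLR α ν lam filling

open LR public

Pairs : (α β lam ν : Partition) → Set
Pairs α β lam ν = LR α ν lam × LR β (ν ′) lam

record X (α β : Partition) (k : ℕ) : Set where
  constructor mkX
  field
    lam ν : Partition
    .ℓ≤k  : ℓ lam ≤ k
    pair  : Pairs α β lam ν

sgn : ∀ {α β k} → X α β k → ℤ
sgn χ = -1ℤ ^ℤ ∣ X.ν χ ∣

{-# OPTIONS --safe #-}
module Submission where

-- Write γ = β′.  A pair of Littlewood–Richardson tableaux with a one-row content
-- consists of 1s only, so it is determined by ν, and ν is admissible exactly when
-- α/ν and β/ν′ are horizontal strips: αᵢ₊₁ ≤ νᵢ ≤ αᵢ and γᵢ - 1 ≤ νᵢ ≤ γᵢ for all i.
-- These conditions concern each row separately.  If αᵢ₊₁ < γᵢ ≤ αᵢ for some i, then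
-- both νᵢ = γᵢ and νᵢ = γᵢ - 1 are allowed, and exchanging them in one fixed such row
-- is the involution.  Otherwise an admissible ν forces γᵢ = αᵢ + 1 or γᵢ = αᵢ₊₁ in
-- each row, the former exactly for the rows i < r for some r; |α| = |γ| then gives
-- αᵣ = r, and removing this row from α yields a μ with α = μ₍₁₎ and β = (μ′)₍₁₎.

open import Algebra.Properties.CommutativeSemigroup using (interchange)
open import Data.Bool.Base using (true; false; if_then_else_)
open import Data.Empty using (⊥; ⊥-elim)
open import Data.Irrelevant using (Irrelevant; [_])
open import Data.Integer.Base using (-_; -1ℤ) renaming (_^_ to _^ℤ_)
import Data.Integer.Properties as ℤ
open import Data.List.Base using (List; []; _∷_; map; length; filter; concat; reverse; replicate; applyUpTo; upTo)
open import Data.List.Extrema.Nat using (max≤v⁺; xs≤max)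
open import Data.List.Membership.Propositional.Properties using (∈-map⁺; ∈-filter⁺; ∈-upTo⁺)
open import Data.List.Properties using (filter-accept; filter-reject; filter-some; length-++; length-map; length-applyUpTo; map-id; length-replicate; ≡-dec)
open import Data.List.Relation.Binary.Permutation.Propositional using (↭-sym)
open import Data.List.Relation.Binary.Permutation.Propositional.Properties using (filter-↭; ↭-length; ↭-reverse; All-resp-↭)
open import Data.List.Relation.Unary.All as All using (All; []; _∷_)
import Data.List.Relation.Unary.All.Properties as All
open import Data.List.Relation.Unary.Any using (here)
open import Data.List.Relation.Unary.Linked using (Linked; []; [-]; _∷_; tail; linked?)
import Data.List.Relation.Unary.Linked.Properties as Linked
open import Data.List.Sort.Base using (module SortingAlgorithm)
open import Data.Nat.Base
open import Data.Nat.ListAction using (sum)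
open import Data.Nat.Properties
open import Data.Product using (∃-syntax; Σ-syntax; _×_; _,_; proj₁; proj₂)
open import Data.Sum.Base using (_⊎_; inj₁; inj₂)
open import Defs
open import Function.Base using (_∘_)
open import Relation.Binary.Properties.DecTotalOrder ≤-decTotalOrder using (≥-decTotalOrder)
open import Data.List.Sort.InsertionSort ≥-decTotalOrder using (insertionSort)
open import Relation.Binary.PropositionalEquality
open import Relation.Nullary using (¬_; Dec; ofʸ; ofⁿ; yes; no; contradiction; recompute)
open import Relation.Nullary.Decidable using (_×-dec_)
open SortingAlgorithm insertionSort using (sort-↭)

private variable
  A : Set
  P : A → Set

-- The proofs carried by tableaux and by elements of `X` are irrelevant. They may still be used for
-- a decidable conclusion, here always an equality or `⊥`.
recompute-from : ∀ {A B : Set} → Dec B → Irrelevant A → (A → B) → B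
recompute-from b? [ a ] f = recompute b? (f a)

-- Reduces comparisons of row lengths to inclusions of boxes, the form in which conjugation merely
-- swaps the two coordinates.
≤-from-< : ∀ {a b} → (∀ j → j < a → j < b) → a ≤ b
≤-from-< {zero}  _ = z≤n
≤-from-< {suc a} h = h a ≤-refl

-- Positions in lists

nth-≥ : ∀ {d : A} xs {i} → length xs ≤ i → nth d xs i ≡ d
nth-≥ []       _       = refl
nth-≥ (x ∷ xs) (s≤s p) = nth-≥ xs p

nth-map : ∀ {B : Set} (f : A → B) {d e} xs {i} → i < length xs →
          nth e (map f xs) i ≡ f (nth d xs i)
nth-map f (x ∷ xs) {zero}  _       = refl
nth-map f (x ∷ xs) {suc i} (s≤s p) = nth-map f xs p

nth-applyUpTo : ∀ {d : A} f n {i} → i < n → nth d (applyUpTo f n) i ≡ f i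
nth-applyUpTo f (suc n) {zero}  _       = refl
nth-applyUpTo f (suc n) {suc i} (s≤s p) = nth-applyUpTo (f ∘ suc) n p

all⇒nth : ∀ {d xs i} → All P xs → i < length xs → P (nth d xs i)
all⇒nth {i = zero}  (p ∷ _)  _       = p
all⇒nth {i = suc i} (_ ∷ ps) (s≤s q) = all⇒nth ps q

nth⇒all : ∀ {d} xs → (∀ i → i < length xs → P (nth d xs i)) → All P xs
nth⇒all []       _ = []
nth⇒all (x ∷ xs) h = h 0 z<s ∷ nth⇒all xs (λ i p → h (suc i) (s<s p))

-- Positivity excludes trailing zeros, which `nth 0` could not tell from its default value.
nth-ext : ∀ {xs ys} → All (0 <_) xs → All (0 <_) ys →
          (∀ i → nth 0 xs i ≡ nth 0 ys i) → xs ≡ ys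
nth-ext []       []       _ = refl
nth-ext []       (p ∷ _)  h = contradiction (h 0) (<⇒≢ p)
nth-ext (p ∷ _)  []       h = contradiction (sym (h 0)) (<⇒≢ p)
nth-ext (_ ∷ ps) (_ ∷ qs) h = cong₂ _∷_ (h 0) (nth-ext ps qs (h ∘ suc))

nth-antitone-suc : ∀ {rs} → Linked _≥_ rs → ∀ i → nth 0 rs (suc i) ≤ nth 0 rs i
nth-antitone-suc []        i       = z≤n
nth-antitone-suc [-]       i       = z≤n
nth-antitone-suc (r ∷ _)   zero    = r
nth-antitone-suc (_ ∷ rs)  (suc i) = nth-antitone-suc rs i

antitone : ∀ {f : ℕ → ℕ} → (∀ i → f (suc i) ≤ f i) → ∀ {i j} → i ≤ j → f j ≤ f i
antitone {f} h {i} {j} i≤j with j | ≤⇒≤′ i≤j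
... | _ | ≤′-refl     = ≤-refl
... | suc k | ≤′-step p = ≤-trans (h k) (antitone {f} h (≤′⇒≤ p))

-- Finite sums

sumTo : (ℕ → ℕ) → ℕ → ℕ
sumTo f n = sum (applyUpTo f n)

sumTo-cong : ∀ {f g} n → (∀ i → f i ≡ g i) → sumTo f n ≡ sumTo g n
sumTo-cong zero    h = refl
sumTo-cong (suc n) h = cong₂ _+_ (h 0) (sumTo-cong n (h ∘ suc))

sumTo-0 : ∀ n → sumTo (λ _ → 0) n ≡ 0
sumTo-0 zero    = refl
sumTo-0 (suc n) = sumTo-0 n

sumTo-+ : ∀ f g n → sumTo (λ i → f i + g i) n ≡ sumTo f n + sumTo g n
sumTo-+ f g zero    = refl
sumTo-+ f g (suc n) = trans (cong (f 0 + g 0 +_) (sumTo-+ (f ∘ suc) (g ∘ suc) n))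
  (interchange +-commutativeSemigroup (f 0) (g 0) _ _)

sumTo-suc-at : ∀ {f g i n} → i < n → (∀ j → j ≢ i → g j ≡ f j) → g i ≡ suc (f i) →
               sumTo g n ≡ suc (sumTo f n)
sumTo-suc-at {i = zero}  {suc n} _ off at =
  cong₂ _+_ at (sumTo-cong n (λ j → off (suc j) λ ()))
sumTo-suc-at {f} {i = suc i} {suc n} (s≤s p) off at = trans
  (cong₂ _+_ (off 0 λ ()) (sumTo-suc-at p (λ j j≢i → off (suc j) (j≢i ∘ suc-injective)) at))
  (+-suc (f 0) _)

-- Since `h 0 ≡ 0`, positions past the end of `rs` contribute nothing. Hence several partitions can
-- be summed up to one common bound.
sumTo-nth : ∀ (h : ℕ → ℕ) → h 0 ≡ 0 → ∀ rs n → length rs ≤ n →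
            sumTo (h ∘ nth 0 rs) n ≡ sum (map h rs)
sumTo-nth h h0 []       n       _       = trans (sumTo-cong n (λ _ → h0)) (sumTo-0 n)
sumTo-nth h h0 (r ∷ rs) (suc n) (s≤s p) = cong (h r +_) (sumTo-nth h h0 rs n p)

-- The contribution of a row of length `r` to column `j`; as a sequence in `j`, it consists of `r`
-- ones followed by zeros.
indicator : ℕ → ℕ → ℕ
indicator j r = if j <ᵇ r then 1 else 0

sumTo-indicator : ∀ r n → r ≤ n → sumTo (λ j → indicator j r) n ≡ r
sumTo-indicator zero    n       _       = sumTo-0 n
sumTo-indicator (suc r) (suc n) (s≤s p) = cong suc (sumTo-indicator r n p)

-- The sequence `f` with its entry at position `r` deleted.
omit : ℕ → (ℕ → ℕ) → ℕ → ℕ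
omit r f i = if i <ᵇ r then f i else f (suc i)

omit-∘ : ∀ (h : ℕ → ℕ) r f i → omit r (h ∘ f) i ≡ h (omit r f i)
omit-∘ h r f i with i <ᵇ r
... | true  = refl
... | false = refl

sumTo-omit : ∀ f {r n} → r ≤ n → sumTo f (suc n) ≡ f r + sumTo (omit r f) n
sumTo-omit f {zero}          _       = refl
sumTo-omit f {suc r} {suc n} (s≤s p) = trans (cong (f 0 +_) (sumTo-omit (f ∘ suc) p))
  (trans (sym (+-assoc (f 0) _ _))
  (trans (cong (_+ sumTo (omit r (f ∘ suc)) n) (+-comm (f 0) _)) (+-assoc (f (suc r)) _ _)))

module _ {f : ℕ → ℕ} (f-antitone : ∀ i → f (suc i) ≤ f i) where

  omit-≤ : ∀ r i → omit r f i ≤ f i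
  omit-≤ r i with i <ᵇ r
  ... | true  = ≤-refl
  ... | false = f-antitone i

  ≤-omit : ∀ r i → f (suc i) ≤ omit r f i
  ≤-omit r i with i <ᵇ r
  ... | true  = f-antitone i
  ... | false = ≤-refl

  -- The value `f (suc i)` separates the two sides.
  omit-antitone : ∀ r i → omit r f (suc i) ≤ omit r f i
  omit-antitone r i = ≤-trans (omit-≤ r (suc i)) (≤-omit r i)

-- Column lengths

columnLength-∷ : ∀ r rs j → columnLength (r ∷ rs) j ≡ indicator j r + columnLength rs j
columnLength-∷ r rs j with j <ᵇ r
... | true  = refl
... | false = refl

columnLength-sum : ∀ rs j → columnLength rs j ≡ sum (map (indicator j) rs)
columnLength-sum []       j = refl
columnLength-sum (r ∷ rs) j =
  trans (columnLength-∷ r rs j) (cong (indicator j r +_) (columnLength-sum rs j))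

columnLength-positiveRows : ∀ rs j → columnLength (filter (0 <?_) rs) j ≡ columnLength rs j
columnLength-positiveRows []           j = refl
columnLength-positiveRows (zero  ∷ rs) j = columnLength-positiveRows rs j
columnLength-positiveRows (suc r ∷ rs) j = trans (columnLength-∷ (suc r) _ j)
  (trans (cong (indicator j (suc r) +_) (columnLength-positiveRows rs j))
         (sym (columnLength-∷ (suc r) rs j)))

-- Column lengths see neither the order of the rows nor zero rows. Results of `fromRows` are
-- therefore compared through their columns, and the sorting itself need not be followed.
columnLength-fromRows : ∀ rs j → columnLength (rows (fromRows rs)) j ≡ columnLength rs j
columnLength-fromRows rs j = trans
  (↭-length (filter-↭ (j <?_) (sort-↭ (filter (0 <?_) rs))))
  (columnLength-positiveRows rs j)

-- As the rows decrease, those longer than `j` form an initial segment. With the converse below, the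
-- box `(i , j)` can be tested by its row or by its column.
<nth⇒<columnLength : ∀ {rs} → Linked _≥_ rs → ∀ {i j} → j < nth 0 rs i → i < columnLength rs j
<nth⇒<columnLength {r ∷ rs} dec {i} {j} p with j <? r
<nth⇒<columnLength {r ∷ rs} dec {i} {j} p | no j≮r =
  contradiction (<-≤-trans p (antitone (nth-antitone-suc dec) {0} {i} z≤n)) j≮r
<nth⇒<columnLength {r ∷ rs} dec {zero} {j} p | yes j<r
  rewrite filter-accept (j <?_) {xs = rs} j<r = z<s
<nth⇒<columnLength {r ∷ rs} dec {suc i} {j} p | yes j<r
  rewrite filter-accept (j <?_) {xs = rs} j<r = s<s (<nth⇒<columnLength (tail dec) p)

<columnLength⇒<nth : ∀ {rs} → Linked _≥_ rs → ∀ {i j} → i < columnLength rs j → j < nth 0 rs i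
<columnLength⇒<nth {r ∷ rs} dec {i} {j} p with j <? r
<columnLength⇒<nth {r ∷ rs} dec {i} {j} p | no j≮r
  rewrite filter-reject (j <?_) {xs = rs} j≮r =
  contradiction (<-≤-trans (<columnLength⇒<nth (tail dec) p)
                           (antitone (nth-antitone-suc dec) {0} {suc i} z≤n)) j≮r
<columnLength⇒<nth {r ∷ rs} dec {zero} {j} p | yes j<r = j<r
<columnLength⇒<nth {r ∷ rs} dec {suc i} {j} p | yes j<r
  rewrite filter-accept (j <?_) {xs = rs} j<r = <columnLength⇒<nth (tail dec) (s<s⁻¹ p)

nth-≤-columnLength : ∀ {rs ss} → Linked _≥_ rs → Linked _≥_ ss →
                     (∀ j → columnLength rs j ≡ columnLength ss j) →
                     ∀ i → nth 0 rs i ≤ nth 0 ss i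
nth-≤-columnLength dr ds h i = ≤-from-< λ j p →
  <columnLength⇒<nth ds (subst (i <_) (h j) (<nth⇒<columnLength dr p))

nth-columnLength : ∀ {rs ss} → Linked _≥_ rs → Linked _≥_ ss →
                   (∀ j → columnLength rs j ≡ columnLength ss j) →
                   ∀ i → nth 0 rs i ≡ nth 0 ss i
nth-columnLength dr ds h i =
  ≤-antisym (nth-≤-columnLength dr ds h i) (nth-≤-columnLength ds dr (sym ∘ h) i)

-- Partitions

-- The field is irrelevant, but being decreasing is decidable, so the proof can be recomputed.
rows-decreasing : ∀ μ → Linked _≥_ (rows μ)
rows-decreasing (mkPartition rs dec _) = recompute (linked? _≥?_ rs) dec

rows-positive : ∀ μ → All (0 <_) (rows μ)
rows-positive (mkPartition rs _ pos) = recompute (All.all? (0 <?_) rs) pos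

rows-injective : ∀ {μ ν} → rows μ ≡ rows ν → μ ≡ ν
rows-injective refl = refl

partition-ext : ∀ {μ ν} → (∀ i → row μ i ≡ row ν i) → μ ≡ ν
partition-ext {μ} {ν} h = rows-injective (nth-ext (rows-positive μ) (rows-positive ν) h)

columnLength-ext : ∀ {μ ν} → (∀ j → columnLength (rows μ) j ≡ columnLength (rows ν) j) → μ ≡ ν
columnLength-ext {μ} {ν} h =
  partition-ext (nth-columnLength (rows-decreasing μ) (rows-decreasing ν) h)

row-suc : ∀ μ i → row μ (suc i) ≤ row μ i
row-suc μ = nth-antitone-suc (rows-decreasing μ)

row-antitone : ∀ μ {i j} → i ≤ j → row μ j ≤ row μ i
row-antitone μ = antitone (row-suc μ)

row-≥ : ∀ μ {i} → ℓ μ ≤ i → row μ i ≡ 0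
row-≥ μ = nth-≥ (rows μ)

row-positive⇒< : ∀ μ {i} → 0 < row μ i → i < ℓ μ
row-positive⇒< μ p = ≰⇒> λ q → <⇒≢ p (sym (row-≥ μ q))

row≡0⇒ℓ≤ : ∀ μ {n} → row μ n ≡ 0 → ℓ μ ≤ n
row≡0⇒ℓ≤ μ h = ≮⇒≥ λ p → <⇒≢ (all⇒nth (rows-positive μ) p) (sym h)

sumTo-row : ∀ μ {n} → ℓ μ ≤ n → sumTo (row μ) n ≡ ∣ μ ∣
sumTo-row μ {n} p = trans (sumTo-nth (λ x → x) refl (rows μ) n p) (cong sum (map-id (rows μ)))

columnLength-sumTo : ∀ μ j {n} → ℓ μ ≤ n →
                     columnLength (rows μ) j ≡ sumTo (indicator j ∘ row μ) n
columnLength-sumTo μ j {n} p =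
  trans (columnLength-sum (rows μ) j) (sym (sumTo-nth (indicator j) refl (rows μ) n p))

row-fromRows : ∀ {rs} → Linked _≥_ rs → ∀ i → row (fromRows rs) i ≡ nth 0 rs i
row-fromRows {rs} dec =
  nth-columnLength (rows-decreasing (fromRows rs)) dec (columnLength-fromRows rs)

fromFunction : (ℕ → ℕ) → ℕ → Partition
fromFunction f n = fromRows (applyUpTo f n)

-- Cutting off at `n` loses nothing, because a decreasing `f` with `f n ≡ 0` vanishes from `n` on.
row-fromFunction : ∀ {f n} → (∀ i → f (suc i) ≤ f i) → f n ≡ 0 →
                   ∀ i → row (fromFunction f n) i ≡ f i
row-fromFunction {f} {n} dec fn≡0 i =
  trans (row-fromRows (Linked.applyUpTo⁺₂ f n dec) i) nth≡
  where
  nth≡ : nth 0 (applyUpTo f n) i ≡ f i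
  nth≡ with i <? n
  ... | yes i<n = nth-applyUpTo f n i<n
  ... | no i≮n = trans (nth-≥ (applyUpTo f n) (≤-trans (≤-reflexive (length-applyUpTo f n)) (≮⇒≥ i≮n)))
                       (sym (n≤0⇒n≡0 (≤-trans (antitone dec (≮⇒≥ i≮n)) (≤-reflexive fn≡0))))

-- Conjugation

-- The list of rows of `μ ′` stops at column `row μ 0`, from which on all columns of `μ` are empty.
row-conjugate : ∀ μ j → row (μ ′) j ≡ columnLength (rows μ) j
row-conjugate μ j with j <? row μ 0
... | yes p = nth-applyUpTo _ _ p
... | no p  = trans
  (nth-≥ (rows (μ ′)) (≤-trans (≤-reflexive (length-applyUpTo _ (row μ 0))) (≮⇒≥ p)))
  (sym (n≤0⇒n≡0 (≮⇒≥ λ q → p (<columnLength⇒<nth (rows-decreasing μ) q))))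

<row⇒<conjugate : ∀ μ {i j} → j < row μ i → i < row (μ ′) j
<row⇒<conjugate μ p =
  subst (_ <_) (sym (row-conjugate μ _)) (<nth⇒<columnLength (rows-decreasing μ) p)

<conjugate⇒<row : ∀ μ {i j} → i < row (μ ′) j → j < row μ i
<conjugate⇒<row μ p =
  <columnLength⇒<nth (rows-decreasing μ) (subst (_ <_) (row-conjugate μ _) p)

-- Conjugation is an involution: swapping the coordinates of a box twice restores it.
columnLength-conjugate : ∀ μ i → columnLength (rows (μ ′)) i ≡ row μ i
columnLength-conjugate μ i = trans (sym (row-conjugate (μ ′) i)) (≤-antisym
  (≤-from-< λ j p → <conjugate⇒<row μ (<conjugate⇒<row (μ ′) p))
  (≤-from-< λ j p → <row⇒<conjugate (μ ′) (<row⇒<conjugate μ p)))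

sumTo-columnLength : ∀ {rs} n → All (_≤ n) rs → sumTo (columnLength rs) n ≡ sum rs
sumTo-columnLength n []       = sumTo-0 n
sumTo-columnLength {r ∷ rs} n (p ∷ ps) = begin
  sumTo (columnLength (r ∷ rs)) n
    ≡⟨ sumTo-cong n (columnLength-∷ r rs) ⟩
  sumTo (λ j → indicator j r + columnLength rs j) n
    ≡⟨ sumTo-+ (λ j → indicator j r) (columnLength rs) n ⟩
  sumTo (λ j → indicator j r) n + sumTo (columnLength rs) n
    ≡⟨ cong₂ _+_ (sumTo-indicator r n p) (sumTo-columnLength n ps) ⟩
  r + sum rs ∎
  where open ≡-Reasoning

size-conjugate : ∀ μ → ∣ μ ′ ∣ ≡ ∣ μ ∣
size-conjugate μ = sumTo-columnLength (row μ 0) (nth⇒all (rows μ) λ i _ → row-antitone μ z≤n)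

-- Rank and stabilization

-- The hypotheses speak of the diagonal boxes `(i , i)` only, which conjugation fixes; so the same
-- criterion serves `μ` and `μ ′`.
rank-unique : ∀ μ {r} → (∀ i → i < row μ i → i < r) → (∀ i → i < r → i < row μ i) → rank μ ≡ r
rank-unique μ {r} upper lower = ≤-antisym
  (max≤v⁺ z≤n (All.map⁺ (All.map (upper _) (All.all-filter (λ i → i <? row μ i) (upTo (ℓ μ))))))
  (≤-from-< λ i i<r → All.lookup (xs≤max 0 _)
    (∈-map⁺ suc (∈-filter⁺ (λ i → i <? row μ i)
      (∈-upTo⁺ (row-positive⇒< μ (≤-<-trans z≤n (lower i i<r)))) (lower i i<r))))

columnLength-stabilization : ∀ μ j → columnLength (rows (stabilization μ 1)) j ≡
                                     indicator j (rank μ) + columnLength (rows μ) j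
columnLength-stabilization μ j =
  trans (columnLength-fromRows (rank μ ∷ rows μ) j) (columnLength-∷ (rank μ) (rows μ) j)

-- Horizontal strips and tableaux with a one-row content

record HorizontalStrip (α ν : Partition) : Set where
  field
    contained  : ν ⊆ α
    interlaced : ∀ i → row α (suc i) ≤ row ν i

rowLengths : Partition → Partition → List ℕ
rowLengths α ν = applyUpTo (λ i → row α i ∸ row ν i) (ℓ α)

Ones : Filling → Set
Ones = All (All (_≡ 1))

ones : Partition → Partition → Filling
ones α ν = map (λ m → replicate m 1) (rowLengths α ν)

onesRow : ∀ {w} → All (_≡ 1) w → w ≡ replicate (length w) 1
onesRow []          = refl
onesRow (refl ∷ ps) = cong (1 ∷_) (onesRow ps)

ones-unique : ∀ {α ν T} → map length T ≡ rowLengths α ν → Ones T → T ≡ ones α ν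
ones-unique shape os = trans (byLengths os) (cong (map (λ m → replicate m 1)) shape)
  where
  byLengths : ∀ {T} → Ones T → T ≡ map (λ m → replicate m 1) (map length T)
  byLengths []       = refl
  byLengths (p ∷ ps) = cong₂ _∷_ (onesRow p) (byLengths ps)

ones-Ones : ∀ α ν → Ones (ones α ν)
ones-Ones α ν = All.map⁺ (All.universal (λ m → All.replicate⁺ m refl) (rowLengths α ν))

ones-shape : ∀ α ν → map length (ones α ν) ≡ rowLengths α ν
ones-shape α ν = lengths (rowLengths α ν)
  where
  lengths : ∀ ms → map length (map (λ m → replicate m 1) ms) ≡ ms
  lengths []       = refl
  lengths (m ∷ ms) = cong₂ _∷_ (length-replicate m) (lengths ms)

length-concat : ∀ (T : Filling) → length (concat T) ≡ sum (map length T)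
length-concat []      = refl
length-concat (w ∷ T) = trans (length-++ w) (cong (length w +_) (length-concat T))

count-1 : ∀ {w} → All (_≡ 1) w → count 1 w ≡ length w
count-1 []          = refl
count-1 (refl ∷ ps) = cong suc (count-1 ps)

count-≥2 : ∀ {w} i → All (_≡ 1) w → count (2+ i) w ≡ 0
count-≥2 i []          = refl
count-≥2 i (refl ∷ ps) = count-≥2 i ps

count-≥2⁻¹ : ∀ {w} → All (1 ≤_) w → (∀ i → count (2+ i) w ≡ 0) → All (_≡ 1) w
count-≥2⁻¹ []                  h = []
count-≥2⁻¹ {1 ∷ w}    (_ ∷ ps) h = refl ∷ count-≥2⁻¹ ps h
count-≥2⁻¹ {2+ i ∷ w} (_ ∷ ps) h =
  contradiction (sym (h i)) (<⇒≢ (filter-some (_≟ 2+ i) {xs = 2+ i ∷ w} (here refl)))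

module _ {α ν : Partition} {T : Filling} (shape : map length T ≡ rowLengths α ν) where

  length-filling : length T ≡ ℓ α
  length-filling = trans (sym (length-map length T))
    (trans (cong length shape) (length-applyUpTo _ (ℓ α)))

  length-nth : ∀ {i} → i < ℓ α → length (nth [] T i) ≡ row α i ∸ row ν i
  length-nth {i} p = begin
    length (nth [] T i)      ≡⟨ sym (nth-map length {[]} {0} T (subst (i <_) (sym length-filling) p)) ⟩
    nth 0 (map length T) i   ≡⟨ cong (λ ms → nth 0 ms i) shape ⟩
    nth 0 (rowLengths α ν) i ≡⟨ nth-applyUpTo _ (ℓ α) p ⟩
    row α i ∸ row ν i        ∎
    where open ≡-Reasoning

  -- Outside a row `nth` returns the default 0, so the row lengths from `shape` are needed to see
  -- that a box reads an actual entry.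
  Ones⇒label≡1 : Ones T → ∀ i j → Box α ν i j → label ν T i j ≡ 1
  Ones⇒label≡1 os i j box = all⇒nth
    (all⇒nth os (subst (i <_) (sym length-filling) i<ℓ))
    (subst (j ∸ row ν i <_) (sym (length-nth i<ℓ)) (∸-monoˡ-< inside-α outside-ν))
    where
    open Box box
    i<ℓ : i < ℓ α
    i<ℓ = row-positive⇒< α (≤-<-trans z≤n inside-α)

  positiveLabels⇒all : ν ⊆ α → (∀ i j → Box α ν i j → 1 ≤ label ν T i j) → All (All (1 ≤_)) T
  positiveLabels⇒all ν⊆α h = nth⇒all T λ i i<T → nth⇒all (nth [] T i) λ p p<len →
    let p< = subst (p <_) (length-nth (subst (i <_) length-filling i<T)) p<len
    in subst (λ q → 1 ≤ nth 0 (nth [] T i) q) (m+n∸m≡n (row ν i) p)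
      -- Entry `p` of row `i` of the filling sits in column `row ν i + p`.
      (h i (row ν i + p) record
        { outside-ν = m≤m+n (row ν i) p
        ; inside-α  = subst (row ν i + p <_) (m+[n∸m]≡n (ν⊆α i)) (+-monoʳ-< (row ν i) p<)
        })

module _ {α ν lam : Partition} {T : Filling} (ℓ≤1 : ℓ lam ≤ 1) (isLR : IsLR α ν lam T) where
  open IsLR isLR

  -- A label `2+ i` would be counted by row `suc i` of `lam`, which is empty.
  LR⇒Ones : Ones T
  LR⇒Ones = All.concat⁻ (count-≥2⁻¹ (All.concat⁺ (positiveLabels⇒all {α} {ν} shape contained positiveLabels))
    λ i → trans (content (suc i)) (row-≥ lam (≤-trans ℓ≤1 (s≤s z≤n))))

  LR⇒ones : T ≡ ones α ν
  LR⇒ones = ones-unique {α} {ν} shape LR⇒Ones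

  LR⇒horizontal : HorizontalStrip α ν
  LR⇒horizontal = record
    { contained  = contained
    ; interlaced = λ i → ≮⇒≥ λ ν<α →
        -- Otherwise column `row ν i` meets the strip in both rows `i` and `suc i`, and two labels 1
        -- stand one above the other.
        let upper = record { outside-ν = ≤-refl ; inside-α = <-≤-trans ν<α (row-suc α i) }
            lower = record { outside-ν = row-suc ν i ; inside-α = ν<α }
        in <-irrefl (trans (label≡1 i _ upper)
                           (sym (label≡1 (suc i) _ lower)))
                    (columnsStrict i (suc i) (row ν i) ≤-refl upper lower)
    }
    where label≡1 = Ones⇒label≡1 {α} {ν} shape LR⇒Ones

-- Built with `fromRows`, so that `m ≡ 0` gives the empty partition.
oneRow : ℕ → Partition
oneRow m = fromRows (m ∷ [])

row-oneRow : ∀ m i → row (oneRow m) i ≡ nth 0 (m ∷ []) i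
row-oneRow m = row-fromRows [-]

ℓ-oneRow : ∀ m → ℓ (oneRow m) ≤ 1
ℓ-oneRow m = row≡0⇒ℓ≤ (oneRow m) (row-oneRow m 1)

sumTo-∸ : ∀ {f g : ℕ → ℕ} n → (∀ i → g i ≤ f i) →
          sumTo (λ i → f i ∸ g i) n ≡ sumTo f n ∸ sumTo g n
sumTo-∸ {f} {g} n h = sym (begin
  sumTo f n ∸ sumTo g n
    ≡⟨ cong (_∸ sumTo g n) (sumTo-cong n (λ i → sym (m+[n∸m]≡n (h i)))) ⟩
  sumTo (λ i → g i + (f i ∸ g i)) n ∸ sumTo g n
    ≡⟨ cong (_∸ sumTo g n) (sumTo-+ g (λ i → f i ∸ g i) n) ⟩
  sumTo g n + sumTo (λ i → f i ∸ g i) n ∸ sumTo g n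
    ≡⟨ m+n∸m≡n (sumTo g n) _ ⟩
  sumTo (λ i → f i ∸ g i) n ∎)
  where open ≡-Reasoning

⊆⇒ℓ≤ : ∀ {ν α} → ν ⊆ α → ℓ ν ≤ ℓ α
⊆⇒ℓ≤ {ν} {α} ν⊆α =
  row≡0⇒ℓ≤ ν (n≤0⇒n≡0 (≤-trans (ν⊆α (ℓ α)) (≤-reflexive (row-≥ α ≤-refl))))

horizontal⇒LR : ∀ {α ν} → HorizontalStrip α ν → IsLR α ν (oneRow (∣ α ∣ ∸ ∣ ν ∣)) (ones α ν)
horizontal⇒LR {α} {ν} strip = record
  { contained      = contained
  ; shape          = shape
  ; positiveLabels = λ i j b → ≤-reflexive (sym (label≡1 i j b))
  ; rowsWeak       = λ i j j₁ _ b b₁ →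
      ≤-reflexive (trans (label≡1 i j b) (sym (label≡1 i j₁ b₁)))
  -- Vacuous: a horizontal strip has no two boxes in one column.
  ; columnsStrict  = λ i i₁ j i<i₁ b b₁ → contradiction
      (≤-trans (row-antitone α i<i₁) (≤-trans (interlaced i) (Box.outside-ν b)))
      (<⇒≱ (Box.inside-α b₁))
  ; content        = content
  -- The label that must not prevail is at least 2, and there is none.
  ; lattice        = λ { (suc i) _ n → ≤-trans
      (≤-reflexive (count-≥2 i (All.take⁺ n (All.concat⁺ (All.map⁺ (All.map reverse⁺ os)))))) z≤n }
  }
  where
  open HorizontalStrip strip
  os = ones-Ones α ν
  shape = ones-shape α ν
  label≡1 = Ones⇒label≡1 {α} {ν} shape os

  reverse⁺ : ∀ {w} → All (_≡ 1) w → All (_≡ 1) (reverse w)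
  reverse⁺ ps = All-resp-↭ (↭-sym (↭-reverse _)) ps

  content : ∀ i → count (suc i) (concat (ones α ν)) ≡ row (oneRow (∣ α ∣ ∸ ∣ ν ∣)) i
  content (suc i) = trans (count-≥2 i (All.concat⁺ os)) (sym (row-oneRow (∣ α ∣ ∸ ∣ ν ∣) (suc i)))
  content zero    = begin
    count 1 (concat (ones α ν))            ≡⟨ count-1 (All.concat⁺ os) ⟩
    length (concat (ones α ν))             ≡⟨ length-concat (ones α ν) ⟩
    sum (map length (ones α ν))            ≡⟨ cong sum shape ⟩
    sumTo (λ i → row α i ∸ row ν i) (ℓ α)  ≡⟨ sumTo-∸ (ℓ α) contained ⟩
    sumTo (row α) (ℓ α) ∸ sumTo (row ν) (ℓ α)
      ≡⟨ cong₂ _∸_ (sumTo-row α ≤-refl) (sumTo-row ν (⊆⇒ℓ≤ {ν} {α} contained)) ⟩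
    ∣ α ∣ ∸ ∣ ν ∣                          ≡⟨ sym (row-oneRow (∣ α ∣ ∸ ∣ ν ∣) 0) ⟩
    row (oneRow (∣ α ∣ ∸ ∣ ν ∣)) 0         ∎
    where open ≡-Reasoning

-- Vertical strips and conjugation

record VerticalStrip (γ ν : Partition) : Set where
  field
    ν≤γ   : ∀ i → row ν i ≤ row γ i
    γ≤1+ν : ∀ i → row γ i ≤ suc (row ν i)

-- Transpose box by box. The shift of rows in `interlaced` becomes a shift of columns, hence the
-- `suc` in `γ≤1+ν`; column 0 satisfies that bound trivially.
horizontal⇒vertical : ∀ {β ν} → HorizontalStrip β (ν ′) → VerticalStrip (β ′) ν
horizontal⇒vertical {β} {ν} strip = record
  { ν≤γ   = λ i → ≤-from-< λ j p →
      <row⇒<conjugate β (<-≤-trans (<row⇒<conjugate ν p) (contained j))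
  ; γ≤1+ν = λ i → ≤-from-< λ
      { zero    _ → z<s
      ; (suc j) p → s<s (<conjugate⇒<row ν (<-≤-trans (<conjugate⇒<row β p) (interlaced j))) }
  }
  where open HorizontalStrip strip

vertical⇒horizontal : ∀ {β ν} → VerticalStrip (β ′) ν → HorizontalStrip β (ν ′)
vertical⇒horizontal {β} {ν} strip = record
  { contained  = λ j → ≤-from-< λ i p →
      <conjugate⇒<row β (<-≤-trans (<conjugate⇒<row ν p) (ν≤γ i))
  ; interlaced = λ j → ≤-from-< λ i p →
      <row⇒<conjugate ν (s<s⁻¹ (<-≤-trans (<row⇒<conjugate β p) (γ≤1+ν i)))
  }
  where open VerticalStrip strip

-- Elements of `X α β 1` as admissible partitions

LR-ext : ∀ {α ν lam} {t u : LR α ν lam} → filling t ≡ filling u → t ≡ u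
LR-ext refl = refl

filling-unique : ∀ {α ν lam} → .(ℓ lam ≤ 1) → (t : LR α ν lam) → filling t ≡ ones α ν
filling-unique ℓ≤1 (mkLR T isLR) = recompute (≡-dec (≡-dec _≟_) T _) (LR⇒ones ℓ≤1 isLR)

content-unique : ∀ {α ν lam} → .(ℓ lam ≤ 1) → LR α ν lam →
                 ∀ i → row lam i ≡ count (suc i) (concat (ones α ν))
content-unique ℓ≤1 t@(mkLR T isLR) i =
  trans (sym (recompute (_ ≟ _) (IsLR.content isLR i)))
        (cong (count (suc i) ∘ concat) (filling-unique ℓ≤1 t))

-- `ν` determines both fillings, and the first filling determines `lam`. The partitions `lam` and
-- `lam′` are identified first, so that the tableaux to be compared have the same type.
X-ext : ∀ {α β} {χ ψ : X α β 1} → X.ν χ ≡ X.ν ψ → χ ≡ ψ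
X-ext {χ = mkX lam ν ℓ≤1 (t , u)} {mkX lam′ .ν ℓ≤1′ (t′ , u′)} refl
  with refl ← partition-ext {lam} {lam′}
    (λ i → trans (content-unique ℓ≤1 t i) (sym (content-unique ℓ≤1′ t′ i))) =
  cong₂ (λ t u → mkX lam ν ℓ≤1 (t , u))
    (LR-ext (trans (filling-unique ℓ≤1 t) (sym (filling-unique ℓ≤1′ t′))))
    (LR-ext (trans (filling-unique ℓ≤1 u) (sym (filling-unique ℓ≤1′ u′))))

record Admissible (α γ ν : Partition) : Set where
  constructor _&_
  field
    horizontal : HorizontalStrip α ν
    vertical   : VerticalStrip γ ν
  open HorizontalStrip horizontal public
  open VerticalStrip vertical public

module _ {α β : Partition} where

  X⇒admissible : (χ : X α β 1) → Irrelevant (Admissible α (β ′) (X.ν χ))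
  X⇒admissible (mkX lam ν ℓ≤1 (mkLR _ p , mkLR _ q)) =
    [ LR⇒horizontal ℓ≤1 p & horizontal⇒vertical (LR⇒horizontal ℓ≤1 q) ]

  admissible⇒X : ∣ α ∣ ≡ ∣ β ∣ → (ν : Partition) → .(Admissible α (β ′) ν) → X α β 1
  admissible⇒X size ν adm = mkX (oneRow (∣ α ∣ ∸ ∣ ν ∣)) ν (ℓ-oneRow (∣ α ∣ ∸ ∣ ν ∣))
    ( mkLR (ones α ν) (horizontal⇒LR (Admissible.horizontal adm))
    , mkLR (ones β (ν ′))
        -- The second tableau arises with content `∣ β ∣ ∸ ∣ ν ′ ∣`, which has to be matched with
        -- that of the first.
        (subst (λ m → IsLR β (ν ′) (oneRow m) (ones β (ν ′)))
          (sym (cong₂ _∸_ size (sym (size-conjugate ν))))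
          (horizontal⇒LR (vertical⇒horizontal (Admissible.vertical adm)))))

-- The involution

-- For `0 < g` this exchanges `g` and `pred g`, the two lengths that a vertical strip allows for a
-- row of `ν` when the row of `γ` has length `g`.
flip : ℕ → ℕ → ℕ
flip g x with x ≟ g
... | yes _ = pred g
... | no  _ = g

module _ {g x : ℕ} (0<g : 0 < g) (x≤g : x ≤ g) (g≤1+x : g ≤ suc x) where

  flip-cases : (x ≡ g × g ≡ suc (flip g x)) ⊎ (flip g x ≡ g × g ≡ suc x)
  flip-cases with x ≟ g
  ... | yes x≡g = inj₁ (x≡g , sym (suc-pred g {{>-nonZero 0<g}}))
  ... | no x≢g  = inj₂ (refl , ≤-antisym g≤1+x (≤∧≢⇒< x≤g x≢g))

flip-diagonal : ∀ g → flip g g ≡ pred g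
flip-diagonal g with g ≟ g
... | yes _  = refl
... | no g≢g = contradiction refl g≢g

flip-off-diagonal : ∀ {g x} → x ≢ g → flip g x ≡ g
flip-off-diagonal {g} {x} x≢g with x ≟ g
... | yes x≡g = contradiction x≡g x≢g
... | no _    = refl

flip-involutive : ∀ {g x} → 0 < g → x ≤ g → g ≤ suc x → flip g (flip g x) ≡ x
flip-involutive {g} {x} 0<g x≤g g≤1+x with flip-cases 0<g x≤g g≤1+x
... | inj₁ (refl , g≡) = flip-off-diagonal (<⇒≢ (≤-reflexive (sym g≡)))
... | inj₂ (e , refl)  = trans (cong (flip g) e) (flip-diagonal g)

sign-suc : ∀ {m n} → n ≡ suc m → -1ℤ ^ℤ n ≡ - (-1ℤ ^ℤ m)
sign-suc refl = ℤ.-1*i≡-i _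

Swappable : Partition → Partition → ℕ → Set
Swappable α γ i = row α (suc i) < row γ i × row γ i ≤ row α i

module Toggle {α γ : Partition} {i₀ : ℕ} (swappable : Swappable α γ i₀) where

  private
    α<γ = proj₁ swappable
    γ≤α = proj₂ swappable

    0<γ : 0 < row γ i₀
    0<γ = ≤-<-trans z≤n α<γ

  toggledRow : Partition → ℕ → ℕ
  toggledRow ν i with i ≟ i₀
  ... | yes _ = flip (row γ i) (row ν i)
  ... | no  _ = row ν i

  -- Defined for every `ν`, because the involution has admissibility available only irrelevantly.
  -- The bound `ℓ α` suffices for admissible `ν`, as the toggled rows stay within `α`.
  toggle : Partition → Partition
  toggle ν = fromFunction (toggledRow ν) (ℓ α)

  toggledRow-at : ∀ ν → toggledRow ν i₀ ≡ flip (row γ i₀) (row ν i₀)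
  toggledRow-at ν with i₀ ≟ i₀
  ... | yes _ = refl
  ... | no ≢  = contradiction refl ≢

  toggledRow-off : ∀ ν {i} → i ≢ i₀ → toggledRow ν i ≡ row ν i
  toggledRow-off ν {i} i≢i₀ with i ≟ i₀
  ... | yes i≡i₀ = contradiction i≡i₀ i≢i₀
  ... | no _     = refl

  module _ {ν : Partition} (adm : Admissible α γ ν) where
    open Admissible adm

    private
      cases = flip-cases 0<γ (ν≤γ i₀) (γ≤1+ν i₀)

    flip-≤ : flip (row γ i₀) (row ν i₀) ≤ row γ i₀
    flip-≤ with cases
    ... | inj₁ (_ , e) = ≤-trans (n≤1+n _) (≤-reflexive (sym e))
    ... | inj₂ (e , _) = ≤-reflexive e

    ≤-1+flip : row γ i₀ ≤ suc (flip (row γ i₀) (row ν i₀))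
    ≤-1+flip with cases
    ... | inj₁ (_ , e) = ≤-reflexive e
    ... | inj₂ (e , _) = ≤-trans (≤-reflexive (sym e)) (n≤1+n _)

    -- The conditions concern single rows, so only row `i₀` has to be checked. The strict half of
    -- `Swappable` gives its lower bound in `α`, the other half its upper bound.
    toggledRow-bounds : ∀ i → (row α (suc i) ≤ toggledRow ν i × toggledRow ν i ≤ row α i) ×
                              (toggledRow ν i ≤ row γ i × row γ i ≤ suc (toggledRow ν i))
    toggledRow-bounds i with i ≟ i₀
    ... | yes refl = (s≤s⁻¹ (≤-trans α<γ ≤-1+flip) , ≤-trans flip-≤ γ≤α) , (flip-≤ , ≤-1+flip)
    ... | no _     = (interlaced i , contained i) , (ν≤γ i , γ≤1+ν i)

    row-toggle : ∀ i → row (toggle ν) i ≡ toggledRow ν i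
    row-toggle = row-fromFunction {n = ℓ α}
      -- The toggled rows decrease because `row α (suc i)` lies between consecutive ones.
      (λ i → ≤-trans (proj₂ (proj₁ (toggledRow-bounds (suc i)))) (proj₁ (proj₁ (toggledRow-bounds i))))
      (n≤0⇒n≡0 (≤-trans (proj₂ (proj₁ (toggledRow-bounds (ℓ α)))) (≤-reflexive (row-≥ α ≤-refl))))

    toggle-admissible : Admissible α γ (toggle ν)
    toggle-admissible =
        record { contained  = λ i → transport i (_≤ row α i) (proj₂ (proj₁ (toggledRow-bounds i)))
               ; interlaced = λ i → transport i (row α (suc i) ≤_) (proj₁ (proj₁ (toggledRow-bounds i))) }
      & record { ν≤γ   = λ i → transport i (_≤ row γ i) (proj₁ (proj₂ (toggledRow-bounds i)))
               ; γ≤1+ν = λ i → transport i (λ x → row γ i ≤ suc x) (proj₂ (proj₂ (toggledRow-bounds i))) }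
      where
      transport : ∀ i (P : ℕ → Set) → P (toggledRow ν i) → P (row (toggle ν) i)
      transport i P = subst P (sym (row-toggle i))

    row-toggle-at : row (toggle ν) i₀ ≡ flip (row γ i₀) (row ν i₀)
    row-toggle-at = trans (row-toggle i₀) (toggledRow-at ν)

    row-toggle-off : ∀ {i} → i ≢ i₀ → row (toggle ν) i ≡ row ν i
    row-toggle-off i≢i₀ = trans (row-toggle _) (toggledRow-off ν i≢i₀)

  toggle-involutive : ∀ {ν} → Admissible α γ ν → toggle (toggle ν) ≡ ν
  toggle-involutive {ν} adm = partition-ext same
    where
    open Admissible adm
    same : ∀ i → row (toggle (toggle ν)) i ≡ row ν i
    same i with i ≟ i₀
    ... | yes refl = trans (row-toggle-at (toggle-admissible adm))
      (trans (cong (flip (row γ i)) (row-toggle-at adm)) (flip-involutive 0<γ (ν≤γ i) (γ≤1+ν i)))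
    ... | no i≢i₀ = trans (row-toggle-off (toggle-admissible adm) i≢i₀) (row-toggle-off adm i≢i₀)

  size-suc : ∀ {μ ν} → Admissible α γ μ → Admissible α γ ν →
             (∀ i → i ≢ i₀ → row ν i ≡ row μ i) → row ν i₀ ≡ suc (row μ i₀) → ∣ ν ∣ ≡ suc ∣ μ ∣
  size-suc {μ} {ν} admμ admν off at = begin
    ∣ ν ∣                     ≡⟨ sym (sumTo-row ν (⊆⇒ℓ≤ {ν} {α} (Admissible.contained admν))) ⟩
    sumTo (row ν) (ℓ α)       ≡⟨ sumTo-suc-at (row-positive⇒< α (<-≤-trans 0<γ γ≤α)) off at ⟩
    suc (sumTo (row μ) (ℓ α)) ≡⟨ cong suc (sumTo-row μ (⊆⇒ℓ≤ {μ} {α} (Admissible.contained admμ))) ⟩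
    suc ∣ μ ∣                 ∎
    where open ≡-Reasoning

  toggle-sign : ∀ {ν} → Admissible α γ ν → -1ℤ ^ℤ ∣ toggle ν ∣ ≡ - (-1ℤ ^ℤ ∣ ν ∣)
  toggle-sign {ν} adm with flip-cases 0<γ (Admissible.ν≤γ adm i₀) (Admissible.γ≤1+ν adm i₀)
  -- Here toggling removes a box, so `toggle ν` is the smaller partition in `size-suc`; in the other
  -- case it is the larger.
  ... | inj₁ (ν≡γ , γ≡) = sym (trans (cong -_ (sign-suc (size-suc (toggle-admissible adm) adm
      (λ i i≢i₀ → sym (row-toggle-off adm i≢i₀))
      (trans ν≡γ (trans γ≡ (cong suc (sym (row-toggle-at adm))))))))
      (ℤ.neg-involutive _))
  ... | inj₂ (e , γ≡) = sign-suc (size-suc adm (toggle-admissible adm)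
      (λ i i≢i₀ → row-toggle-off adm i≢i₀)
      (trans (row-toggle-at adm) (trans e γ≡)))

-- The exceptional case

upward : (∀ i → P i → P (suc i)) → P 0 → ∀ i → P i
upward step P0 zero    = P0
upward step P0 (suc i) = step i (upward step P0 i)

-- The threshold is the first index below `n` at which `dec` answers with `P`, or `n` itself if
-- there is none; `P` then propagates upwards.
switch : ∀ {P Q : ℕ → Set} → (∀ i → P i ⊎ Q i) → (∀ i → P i → P (suc i)) → ∀ n → P n →
         ∃[ r ] r ≤ n × (∀ i → i < r → Q i) × (∀ i → r ≤ i → P i)
switch dec step n Pn with dec 0
switch dec step n       Pn | inj₁ P0 = 0 , z≤n , (λ _ ()) , λ i _ → upward step P0 i
switch dec step zero    Pn | inj₂ _  = 0 , z≤n , (λ _ ()) , λ i _ → upward step Pn i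
switch dec step (suc n) Pn | inj₂ Q0
  with r , r≤n , below , above ← switch (dec ∘ suc) (step ∘ suc) n Pn =
  suc r , s≤s r≤n , (λ { zero _ → Q0 ; (suc i) (s≤s p) → below i p })
                  , λ { (suc i) (s≤s p) → above i p }

module Exceptional {α β ν : Partition} (size : ∣ α ∣ ≡ ∣ β ∣) (adm : Admissible α (β ′) ν)
                   (none : ∀ i → ¬ Swappable α (β ′) i) where
  open Admissible adm

  private
    γ : Partition
    γ = β ′

    N : ℕ
    N = ℓ α + ℓ γ

  -- If `row γ i ≤ row α i`, then non-swappability and `row α (suc i) ≤ row ν i ≤ row γ i` leave
  -- only the first value. Otherwise `row γ i ≤ suc (row ν i) ≤ suc (row α i)` leaves only the
  -- second.
  shifted-or-extended : ∀ i → row γ i ≡ row α (suc i) ⊎ row γ i ≡ suc (row α i)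
  shifted-or-extended i with row γ i ≤? row α i
  ... | yes γ≤α = inj₁ (≤-antisym (≮⇒≥ λ α<γ → none i (α<γ , γ≤α))
                                  (≤-trans (interlaced i) (ν≤γ i)))
  ... | no γ≰α  = inj₂ (≤-antisym (≤-trans (γ≤1+ν i) (s≤s (contained i))) (≰⇒> γ≰α))

  -- An extended row directly after a shifted one would be longer than it by one.
  shifted-suc : ∀ i → row γ i ≡ row α (suc i) → row γ (suc i) ≡ row α (2+ i)
  shifted-suc i γ≡ with shifted-or-extended (suc i)
  ... | inj₁ e = e
  ... | inj₂ e = contradiction (row-suc γ i)
    (<⇒≱ (≤-reflexive (trans (cong suc γ≡) (sym e))))

  shifted-N : row γ N ≡ row α (suc N)
  shifted-N = trans (row-≥ γ (m≤n+m (ℓ γ) (ℓ α)))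
    (sym (row-≥ α (≤-trans (m≤m+n (ℓ α) (ℓ γ)) (n≤1+n N))))

  private
    threshold = switch shifted-or-extended shifted-suc N shifted-N

  r : ℕ
  r = proj₁ threshold

  r≤N : r ≤ N
  r≤N = proj₁ (proj₂ threshold)

  -- Both alternatives in one formula: `γ` is `α` with row `r` deleted and one box added to each of
  -- the first `r` rows.
  row-γ : ∀ i → row γ i ≡ indicator i r + omit r (row α) i
  row-γ i with i <ᵇ r | <ᵇ-reflects-< i r
  ... | true  | ofʸ i<r = proj₁ (proj₂ (proj₂ threshold)) i i<r
  ... | false | ofⁿ i≮r = proj₂ (proj₂ (proj₂ threshold)) i (≮⇒≥ i≮r)

  -- Passing from `α` to `γ` loses the `row α r` boxes of the deleted row and gains `r` boxes, while
  -- the sizes agree.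
  row-α-r : row α r ≡ r
  row-α-r = +-cancelʳ-≡ (sumTo (omit r (row α)) N) (row α r) r (begin
    row α r + sumTo (omit r (row α)) N      ≡⟨ sym (sumTo-omit (row α) r≤N) ⟩
    sumTo (row α) (suc N)                   ≡⟨ sumTo-row α (≤-trans (m≤m+n (ℓ α) (ℓ γ)) (n≤1+n N)) ⟩
    ∣ α ∣                                   ≡⟨ trans size (sym (size-conjugate β)) ⟩
    ∣ γ ∣                                   ≡⟨ sym (sumTo-row γ (m≤n+m (ℓ γ) (ℓ α))) ⟩
    sumTo (row γ) N                         ≡⟨ sumTo-cong N row-γ ⟩
    sumTo (λ i → indicator i r + omit r (row α) i) N
      ≡⟨ sumTo-+ (λ i → indicator i r) (omit r (row α)) N ⟩
    sumTo (λ i → indicator i r) N + sumTo (omit r (row α)) N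
      ≡⟨ cong (_+ sumTo (omit r (row α)) N) (sumTo-indicator r N r≤N) ⟩
    r + sumTo (omit r (row α)) N            ∎)
    where open ≡-Reasoning

  μ : Partition
  μ = fromFunction (omit r (row α)) N

  omit-N : omit r (row α) N ≡ 0
  omit-N = n≤0⇒n≡0 (≤-trans (omit-≤ (row-suc α) r N)
                            (≤-reflexive (row-≥ α (m≤m+n (ℓ α) (ℓ γ)))))

  row-μ : ∀ i → row μ i ≡ omit r (row α) i
  row-μ = row-fromFunction (omit-antitone (row-suc α) r) omit-N

  ℓ-μ : ℓ μ ≤ N
  ℓ-μ = row≡0⇒ℓ≤ μ (trans (row-μ N) omit-N)

  -- Since `row α r ≡ r`, the rows of `μ` from position `r` on have length at most `r`, and those
  -- before it length at least `r`. So the Durfee square of `μ` has side `r`.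
  diagonal-< : ∀ i → i < row μ i → i < r
  diagonal-< i i<μ = ≰⇒> λ r≤i → <⇒≱ i<μ (begin
    row μ i           ≡⟨ row-μ i ⟩
    omit r (row α) i ≤⟨ omit-≤ (row-suc α) r i ⟩
    row α i           ≤⟨ row-antitone α r≤i ⟩
    row α r           ≡⟨ row-α-r ⟩
    r                 ≤⟨ r≤i ⟩
    i                 ∎)
    where open ≤-Reasoning

  <-diagonal : ∀ i → i < r → i < row μ i
  <-diagonal i i<r = begin-strict
    i                 <⟨ i<r ⟩
    r                 ≡⟨ sym row-α-r ⟩
    row α r           ≤⟨ row-antitone α i<r ⟩
    row α (suc i)     ≤⟨ ≤-omit (row-suc α) r i ⟩
    omit r (row α) i  ≡⟨ sym (row-μ i) ⟩
    row μ i           ∎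
    where open ≤-Reasoning

  rank-μ : rank μ ≡ r
  rank-μ = rank-unique μ diagonal-< <-diagonal

  rank-μ′ : rank (μ ′) ≡ r
  rank-μ′ = rank-unique (μ ′) (λ i p → diagonal-< i (<conjugate⇒<row μ p))
                              (λ i p → <row⇒<conjugate μ (<-diagonal i p))

  -- Putting the deleted row back restores `α`, and its length `r` is the rank of `μ`. Comparing
  -- columns avoids locating where the sorting inserts it.
  α≡ : α ≡ stabilization μ 1
  α≡ = columnLength-ext λ j → begin
    columnLength (rows α) j
      ≡⟨ columnLength-sumTo α j (≤-trans (m≤m+n (ℓ α) (ℓ γ)) (n≤1+n N)) ⟩
    sumTo (indicator j ∘ row α) (suc N)
      ≡⟨ sumTo-omit (indicator j ∘ row α) r≤N ⟩
    indicator j (row α r) + sumTo (omit r (indicator j ∘ row α)) N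
      ≡⟨ cong₂ _+_ (cong (indicator j) (trans row-α-r (sym rank-μ)))
                   (sumTo-cong N λ i → trans (omit-∘ (indicator j) r (row α) i)
                                             (cong (indicator j) (sym (row-μ i)))) ⟩
    indicator j (rank μ) + sumTo (indicator j ∘ row μ) N
      ≡⟨ cong (indicator j (rank μ) +_) (sym (columnLength-sumTo μ j ℓ-μ)) ⟩
    indicator j (rank μ) + columnLength (rows μ) j
      ≡⟨ sym (columnLength-stabilization μ j) ⟩
    columnLength (rows (stabilization μ 1)) j ∎
    where open ≡-Reasoning

  -- The columns of `β` are the rows of `γ`. One more box in each of the first `r` rows of `μ` is,
  -- after transposing, one more row of length `r`.
  β≡ : β ≡ stabilization (μ ′) 1
  β≡ = columnLength-ext λ j → begin
    columnLength (rows β) j                            ≡⟨ sym (row-conjugate β j) ⟩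
    row γ j                                            ≡⟨ row-γ j ⟩
    indicator j r + omit r (row α) j
      ≡⟨ cong₂ _+_ (cong (indicator j) (sym rank-μ′))
                   (trans (sym (row-μ j)) (sym (columnLength-conjugate μ j))) ⟩
    indicator j (rank (μ ′)) + columnLength (rows (μ ′)) j
      ≡⟨ sym (columnLength-stabilization (μ ′) j) ⟩
    columnLength (rows (stabilization (μ ′) 1)) j      ∎
    where open ≡-Reasoning

swappable? : ∀ α γ i → Dec (Swappable α γ i)
swappable? α γ i = (row α (suc i) <? row γ i) ×-dec (row γ i ≤? row α i)

-- A swappable row of `α` is nonempty, so a finite search settles whether one exists.
swappable⇒<ℓ : ∀ {α γ i} → Swappable α γ i → i < ℓ α
swappable⇒<ℓ {α} (α<γ , γ≤α) = row-positive⇒< α (≤-<-trans z≤n (<-≤-trans α<γ γ≤α))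

theorem4p9 : (α β : Partition) → ∣ α ∣ ≡ ∣ β ∣ →
    ¬ (∃[ μ ] α ≡ stabilization μ 1 × β ≡ stabilization (μ ′) 1) →
    Σ[ φ ∈ (X α β 1 → X α β 1) ]
    (∀ χ → φ (φ χ) ≡ χ) × (∀ χ → sgn (φ χ) ≡ - sgn χ)
theorem4p9 α β size notStable with anyUpTo? (swappable? α (β ′)) (ℓ α)
... | yes (i , _ , swappable) = φ , involutive , sign
  where
  open Toggle {α} {β ′} {i} swappable

  φ : X α β 1 → X α β 1
  -- As admissibility enters irrelevantly, `X.ν (φ χ)` computes to `toggle (X.ν χ)`, on which
  -- `involutive` and `sign` rely.
  φ χ = toggleX (X.ν χ) (X⇒admissible χ)
    where
    toggleX : ∀ ν → Irrelevant (Admissible α (β ′) ν) → X α β 1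
    toggleX ν [ adm ] = admissible⇒X size (toggle ν) (toggle-admissible adm)

  involutive : ∀ χ → φ (φ χ) ≡ χ
  -- Comparing lists of rows makes the goal a decidable equality, as `recompute-from` requires.
  involutive χ = X-ext {χ = φ (φ χ)} {χ} (rows-injective
    (recompute-from (≡-dec _≟_ _ _) (X⇒admissible χ) (cong rows ∘ toggle-involutive)))

  sign : ∀ χ → sgn (φ χ) ≡ - sgn χ
  sign χ = recompute-from (_ ℤ.≟ _) (X⇒admissible χ) toggle-sign
-- Without a swappable row, any element of `X α β 1` would yield the excluded `μ`; the involution is
-- the empty map.
... | no none = ⊥-elim ∘ empty , ⊥-elim ∘ empty , ⊥-elim ∘ empty
  where
  empty : X α β 1 → ⊥
  empty χ = recompute-from (no λ ()) (X⇒admissible χ) λ adm →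
    let open Exceptional {α} {β} size adm (λ i s → none (i , swappable⇒<ℓ {α} {β ′} s , s))
    in notStable (μ , α≡ , β≡)
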